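{- Every finite digraph with minimum out-degree at least $3$ has at least $2$ distinct friendly partitions.
   Context: Digraphs have no loops and no parallel arcs in the same direction. A friendly partition of a digraph $G=(V,E)$ is an (unordered) partition $\{V_1,V_2\}$ of $V$ into two nonempty sets such that every vertex has at least one out-neighbor in its own part. -}

module Defs where

open import Data.Nat using (ℕ; _≥_)
open import Data.Fin using (Fin)
import Data.Fin as Fin
open import Data.Sum using (_⊎_)
open import Data.Bool using (Bool; true; false; not)
open import Data.Product using (Σ; ∃; _×_; _,_)
open import Relation.Binary.PropositionalEquality using (_≡_)
open import Relation.Nullary using (¬_)

open import Data.Nat using (suc; zero)

-- A finite digraph on vertex set Fin n: adjacency  arc u v = true  iff u → v.
-- Parallel arcs in the same direction are excluded automatically by the
-- Bool-valued representation; loops are excluded by the field noLoop.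
record Digraph (n : ℕ) : Set where
  field
    arc    : Fin n → Fin n → Bool
    noLoop : ∀ v → arc v v ≡ false
open Digraph public

count : ∀ {n} → (Fin n → Bool) → ℕ
count {zero}  f = 0
count {suc n} f with f Fin.zero
... | true  = suc (count (λ i → f (Fin.suc i)))
... | false = count (λ i → f (Fin.suc i))

outDeg : ∀ {n} → Digraph n → Fin n → ℕ
outDeg G v = count (arc G v)

minOutDegAtLeast : ∀ {n} → ℕ → Digraph n → Set
minOutDegAtLeast k G = ∀ v → outDeg G v ≥ k

-- A 2-colouring c : Fin n → Bool represents the partition
-- {c⁻¹(true), c⁻¹(false)}; c and (not ∘ c) represent the same
-- (unordered) partition.
Friendly : ∀ {n} → Digraph n → (Fin n → Bool) → Set
Friendly G c =
    (∃ λ v → c v ≡ true)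
  × (∃ λ v → c v ≡ false)
  × (∀ v → ∃ λ w → (arc G v w ≡ true) × (c w ≡ c v))

SamePartition : ∀ {n} → (Fin n → Bool) → (Fin n → Bool) → Set
SamePartition c d = (∀ v → d v ≡ c v) ⊎ (∀ v → d v ≡ not (c v))

{-# OPTIONS --safe #-}
module Submission where

-- Call a nonempty set of vertices a core if each of its vertices has an out-neighbour in it; cores
-- stand in for cycles.  Two disjoint cores extend to a friendly partition.  Trim all out-degrees to 3
-- and take a counterexample with the fewest vertices.  No proper subset is closed under
-- out-neighbours, and contracting an arc u → v without reverse arc would lift two friendly partitions,
-- so u and v have a common in-neighbour.  If the partition {A, B} is the only friendly one, then a
-- vertex of A with an arc to B lies in every core of A, since otherwise it could change sides.
--
-- If there are no 2-cycles, every in-neighbourhood contains a core, hence at least 3 vertices;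
-- counting arcs, every in-neighbourhood is a core of size exactly 3.  Choose p so that In(p) meets
-- every core (any p if no two cores are disjoint, else a vertex of A with an arc to B).  A sink z of V ∖ In(p) has out-set In(p),
-- so In(z) is a core disjoint from In(p), a contradiction.
--
-- If u, v form a 2-cycle, then {u, v} and B = V ∖ {u, v} form a friendly partition.  For x ∈ B with an
-- arc to {u, v}, the set B ∖ {x} has no core, and a sink of it has out-set {u, v, x}; it follows
-- that every vertex of B dominating one of u, v dominates both.  The other vertices of B form an
-- acyclic set, through which two disjoint paths lead from out-neighbours of u and v to vertices
-- dominating both; this yields a friendly partition separating u from v.

open import Defs
import Algebra.Properties.CommutativeMonoid.Sum
open import Data.Bool using (Bool; true; false; not; _∨_)
open import Data.Bool.Properties using (not-¬; ¬-not) renaming (_≟_ to _≟ᵇ_)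
open import Data.Empty using (⊥)
open import Data.Fin using (Fin; zero; suc)
open import Data.Fin.Properties using (any?; all?; _≟_)
open import Data.Fin.Subset using (Subset; inside; outside; _∈_; _∉_; _⊆_; ∣_∣; _-_; _─_; _∪_; ∁; ⁅_⁆; ⊤; Nonempty)
open import Data.Fin.Subset.Properties
open import Data.Nat using (ℕ; zero; suc; _+_; _≤_; _<_; _≥_; z≤n; s≤s)
open import Data.Nat.Induction using (<-rec)
open import Data.Nat.Properties using (≤-trans; ≤-reflexive; ≤-<-trans; ≤⇒≯; +-0-commutativeMonoid; +-monoʳ-≤; +-mono-≤; +-cancelˡ-≤; +-cancelʳ-≤; +-monoˡ-≤; +-suc; n≤1+n)
open import Data.Product using (∃; _×_; _,_; proj₁; proj₂; map₂)
open import Data.Sum using (_⊎_; inj₁; inj₂; [_,_]′) renaming (map to ⊎-map)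
open import Data.Vec using ([]; _∷_; here; there; tabulate; lookup; _[_]≔_)
open import Data.Vec.Functional using (updateAt)
open import Data.Vec.Functional.Properties using (updateAt-updates; updateAt-minimal)
open import Data.Vec.Properties using (lookup∘tabulate; []=⇒lookup; lookup⇒[]=; lookup∘update; lookup∘update′)
open import Function using (_∘_; const; id)
open import Relation.Binary.PropositionalEquality using (_≡_; _≢_; refl; sym; trans; cong; cong₂; subst; ≢-sym; _≗_)
open import Relation.Nullary using (¬_; Dec; yes; no; does; contradiction)
open import Relation.Nullary.Decidable using (_×-dec_; _⊎-dec_; _→-dec_; ¬?; map′; dec-true; dec-false; decidable-stable)
open import Relation.Unary using (Decidable)

open Algebra.Properties.CommutativeMonoid.Sum +-0-commutativeMonoid using (sum; ∑-comm; sum-cong-≗)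

-- Finite subsets

module _ {n : ℕ} where

  sep : {P : Fin n → Set} → Decidable P → Subset n
  sep P? = tabulate (does ∘ P?)

  module _ {P : Fin n → Set} (P? : Decidable P) where

    ∈-sep⁺ : ∀ {x} → P x → x ∈ sep P?
    ∈-sep⁺ {x} px = lookup⇒[]= x _ (trans (lookup∘tabulate _ x) (dec-true (P? x) px))

    ∈-sep⁻ : ∀ {x} → x ∈ sep P? → P x
    ∈-sep⁻ {x} x∈ with P? x | trans (sym (lookup∘tabulate (does ∘ P?) x)) ([]=⇒lookup x∈)
    ... | yes px | _ = px

x∈p─q⇒x∉q : ∀ {n} {x : Fin n} (p q : Subset n) → x ∈ p ─ q → x ∉ q
x∈p─q⇒x∉q (_ ∷ _) (inside ∷ _) () here
x∈p─q⇒x∉q (_ ∷ p) (_ ∷ q) (there x∈) (there x∈q) = x∈p─q⇒x∉q p q x∈ x∈q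

∣p∪q∣≤∣p∣+∣q∣ : ∀ {n} (p q : Subset n) → ∣ p ∪ q ∣ ≤ ∣ p ∣ + ∣ q ∣
∣p∪q∣≤∣p∣+∣q∣ [] [] = z≤n
∣p∪q∣≤∣p∣+∣q∣ (inside ∷ p) (inside ∷ q) =
  s≤s (≤-trans (∣p∪q∣≤∣p∣+∣q∣ p q) (+-monoʳ-≤ ∣ p ∣ (n≤1+n ∣ q ∣)))
∣p∪q∣≤∣p∣+∣q∣ (inside ∷ p) (outside ∷ q) = s≤s (∣p∪q∣≤∣p∣+∣q∣ p q)
∣p∪q∣≤∣p∣+∣q∣ (outside ∷ p) (inside ∷ q) =
  ≤-trans (s≤s (∣p∪q∣≤∣p∣+∣q∣ p q)) (≤-reflexive (sym (+-suc ∣ p ∣ ∣ q ∣)))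
∣p∪q∣≤∣p∣+∣q∣ (outside ∷ p) (outside ∷ q) = ∣p∪q∣≤∣p∣+∣q∣ p q

∣p[x]≔outside∣ : ∀ {n} {x : Fin n} {p} → x ∈ p → suc ∣ p [ x ]≔ outside ∣ ≡ ∣ p ∣
∣p[x]≔outside∣ here = refl
∣p[x]≔outside∣ {p = inside ∷ _} (there x∈p) = cong suc (∣p[x]≔outside∣ x∈p)
∣p[x]≔outside∣ {p = outside ∷ _} (there x∈p) = ∣p[x]≔outside∣ x∈p

∣p[x]≔inside∣ : ∀ {n} (x : Fin n) p → x ∉ p → ∣ p [ x ]≔ inside ∣ ≡ suc ∣ p ∣
∣p[x]≔inside∣ zero (inside ∷ _) x∉p = contradiction here x∉p
∣p[x]≔inside∣ zero (outside ∷ _) _ = refl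
∣p[x]≔inside∣ (suc x) (inside ∷ p) x∉p = cong suc (∣p[x]≔inside∣ x p (x∉p ∘ there))
∣p[x]≔inside∣ (suc x) (outside ∷ p) x∉p = ∣p[x]≔inside∣ x p (x∉p ∘ there)

subset-of-size : ∀ {n} k (p : Subset n) → k ≤ ∣ p ∣ → ∃ λ q → q ⊆ p × ∣ q ∣ ≡ k
subset-of-size {n} zero p _ = Data.Fin.Subset.⊥ , ⊥⊆ , ∣⊥∣≡0 n
subset-of-size (suc k) (inside ∷ p) (s≤s k≤) =
  let q , q⊆p , ∣q∣ = subset-of-size k p k≤ in inside ∷ q , in⊆in q⊆p , cong suc ∣q∣
subset-of-size (suc k) (outside ∷ p) k≤ =
  let q , q⊆p , ∣q∣ = subset-of-size (suc k) p k≤ in outside ∷ q , out⊆ q⊆p , ∣q∣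

module _ {n : ℕ} {p q : Subset n} where

  larger⇒∃∉ : ∣ q ∣ < ∣ p ∣ → ∃ λ x → x ∈ p × x ∉ q
  larger⇒∃∉ q<p with any? (λ x → (x ∈? p) ×-dec ¬? (x ∈? q))
  ... | yes found = found
  ... | no none = contradiction q<p (≤⇒≯ (p⊆q⇒∣p∣≤∣q∣ λ {x} x∈p →
          decidable-stable (x ∈? q) λ x∉q → none (x , x∈p , x∉q)))

  ⊆∧∣≤∣⇒⊇ : p ⊆ q → ∣ q ∣ ≤ ∣ p ∣ → q ⊆ p
  ⊆∧∣≤∣⇒⊇ p⊆q q≤p {x} x∈q = decidable-stable (x ∈? p) λ x∉p →
    ≤⇒≯ q≤p (p⊂q⇒∣p∣<∣q∣ (p⊆q , x , x∈q , x∉p))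

∣⁅x⁆∪⁅y⁆∣≤2 : ∀ {n} (x y : Fin n) → ∣ ⁅ x ⁆ ∪ ⁅ y ⁆ ∣ ≤ 2
∣⁅x⁆∪⁅y⁆∣≤2 x y = ≤-trans (∣p∪q∣≤∣p∣+∣q∣ ⁅ x ⁆ ⁅ y ⁆)
  (≤-reflexive (cong₂ _+_ (∣⁅x⁆∣≡1 x) (∣⁅x⁆∣≡1 y)))

module _ {n : ℕ} {p : Subset n} where

  avoid₁ : 2 ≤ ∣ p ∣ → ∀ x → ∃ λ y → y ∈ p × y ≢ x
  avoid₁ 2≤ x =
    let y , y∈p , y∉ = larger⇒∃∉ {p = p} (subst (_< ∣ p ∣) (sym (∣⁅x⁆∣≡1 x)) 2≤)
    in y , y∈p , x∉⁅y⁆⇒x≢y y∉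

  avoid₂ : 3 ≤ ∣ p ∣ → ∀ x y → ∃ λ z → z ∈ p × z ≢ x × z ≢ y
  avoid₂ 3≤ x y =
    let z , z∈p , z∉ = larger⇒∃∉ {p = p} (≤-<-trans (∣⁅x⁆∪⁅y⁆∣≤2 x y) 3≤)
    in z , z∈p , x∉⁅y⁆⇒x≢y (z∉ ∘ p⊆p∪q _) , x∉⁅y⁆⇒x≢y (z∉ ∘ q⊆p∪q _ _)

  three-elements : ∀ {x y z} → x ∈ p → y ∈ p → z ∈ p → y ≢ x → z ≢ x → z ≢ y → 3 ≤ ∣ p ∣
  three-elements {x} {y} {z} x∈p y∈p z∈p y≢x z≢x z≢y =
    ≤-trans (s≤s (≤-trans (s≤s 1≤) (x∈p⇒∣p-x∣<∣p∣ y∈))) (x∈p⇒∣p-x∣<∣p∣ x∈p)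
    where
    y∈ = x∈p∧x≢y⇒x∈p-y y∈p y≢x
    z∈ = x∈p∧x≢y⇒x∈p-y (x∈p∧x≢y⇒x∈p-y z∈p z≢x) z≢y
    1≤ : 1 ≤ ∣ p - x - y ∣
    1≤ = ≤-trans (s≤s z≤n) (x∈p⇒∣p-x∣<∣p∣ z∈)

-- Sizes as sums, and double counting

indicator : Bool → ℕ
indicator true  = 1
indicator false = 0

∣tabulate∣ : ∀ {n} (f : Fin n → Bool) → ∣ tabulate f ∣ ≡ sum (indicator ∘ f)
∣tabulate∣ {zero} f = refl
∣tabulate∣ {suc n} f with f zero
... | true  = cong suc (∣tabulate∣ (f ∘ suc))
... | false = ∣tabulate∣ (f ∘ suc)

double-count : ∀ {m n} {R : Fin m → Fin n → Set} (R? : ∀ x y → Dec (R x y)) →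
  sum (λ x → ∣ sep (R? x) ∣) ≡ sum (λ y → ∣ sep (λ x → R? x y) ∣)
double-count R? =
  trans (sum-cong-≗ λ x → ∣tabulate∣ (does ∘ R? x))
  (trans (∑-comm λ x y → indicator (does (R? x y)))
  (sum-cong-≗ λ y → sym (∣tabulate∣ λ x → does (R? x y))))

sum-mono-≤ : ∀ {n} {f g : Fin n → ℕ} → (∀ x → f x ≤ g x) → sum f ≤ sum g
sum-mono-≤ {zero} f≤g = z≤n
sum-mono-≤ {suc n} f≤g = +-mono-≤ (f≤g zero) (sum-mono-≤ (f≤g ∘ suc))

-- No other term can make up for a strict inequality at one position, since f is dominated
-- everywhere. This is the equality case of the double count.
≤∧sum≥⇒≥ : ∀ {n} {f g : Fin n → ℕ} → (∀ x → f x ≤ g x) → sum g ≤ sum f → ∀ x → g x ≤ f x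
≤∧sum≥⇒≥ {suc n} {f} {g} f≤g ∑ zero =
  +-cancelʳ-≤ (sum (g ∘ suc)) (g zero) (f zero)
    (≤-trans ∑ (+-monoʳ-≤ (f zero) (sum-mono-≤ (f≤g ∘ suc))))
≤∧sum≥⇒≥ {suc n} {f} {g} f≤g ∑ (suc x) = ≤∧sum≥⇒≥ (f≤g ∘ suc)
  (+-cancelˡ-≤ (g zero) _ _ (≤-trans ∑ (+-monoˡ-≤ _ (f≤g zero)))) x

-- Cores and friendly colourings

module _ {n : ℕ} (N : Fin n → Subset n) where

  HasOut : Subset n → Fin n → Set
  HasOut S x = ∃ λ y → y ∈ S × y ∈ N x

  hasOut? : ∀ S x → Dec (HasOut S x)
  hasOut? S x = any? λ y → (y ∈? S) ×-dec (y ∈? N x)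

  Core : Subset n → Set
  Core S = Nonempty S × (∀ {x} → x ∈ S → HasOut S x)

  -- Acyclicity of the digraph induced on `S`: every cycle is a core, and every core contains a
  -- cycle.
  Coreless : Subset n → Set
  Coreless S = ∀ C → C ⊆ S → ¬ Core C

  core-or-sink : ∀ S → Nonempty S → Core S ⊎ (∃ λ x → x ∈ S × ¬ HasOut S x)
  core-or-sink S ne with any? (λ x → (x ∈? S) ×-dec ¬? (hasOut? S x))
  ... | yes sink = inj₂ sink
  ... | no none = inj₁ (ne , λ {x} x∈S →
          decidable-stable (hasOut? S x) λ ¬out → none (x , x∈S , ¬out))

  coreless⇒sink : ∀ {S} → Nonempty S → Coreless S → ∃ λ x → x ∈ S × ¬ HasOut S x
  coreless⇒sink {S} ne coreless =
    [ (λ core → contradiction core (coreless S id)) , id ]′ (core-or-sink S ne)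

  -- A sink can be discarded: it is nobody's in-neighbour inside S.
  in-closed⇒core : ∀ S → Nonempty S → (∀ {x} → x ∈ S → ∃ λ y → y ∈ S × x ∈ N y) →
                   ∃ λ C → C ⊆ S × Core C
  in-closed⇒core S = <-rec P step ∣ S ∣ S refl
    where
    P : ℕ → Set
    P k = ∀ S → ∣ S ∣ ≡ k → Nonempty S → (∀ {x} → x ∈ S → ∃ λ y → y ∈ S × x ∈ N y) →
          ∃ λ C → C ⊆ S × Core C
    step : ∀ k → (∀ {j} → j < k → P j) → P k
    step k rec S refl ne inN with core-or-sink S ne
    ... | inj₁ core = S , id , core
    ... | inj₂ (s , s∈S , sink) =
      let y , y∈S , s∈Ny = inN s∈S
          C , C⊆ , core = rec (x∈p⇒∣p-x∣<∣p∣ s∈S) (S - s) refl (y , survives y∈S s∈S s∈Ny)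
            λ x∈ → let x∈S = p─q⊆p S _ x∈ ; z , z∈S , x∈Nz = inN x∈S
                   in z , survives z∈S x∈S x∈Nz , x∈Nz
      in C , p─q⊆p S _ ∘ C⊆ , core
      where
      survives : ∀ {y x} → y ∈ S → x ∈ S → x ∈ N y → y ∈ S - s
      survives y∈S x∈S x∈Ny = x∈p∧x≢y⇒x∈p-y y∈S λ { refl → sink (_ , x∈S , x∈Ny) }

  -- If every vertex of `S` had an in-neighbour in `S`, then `in-closed⇒core` would produce a core.
  coreless⇒source : ∀ {S} → Nonempty S → Coreless S →
                    ∃ λ x → x ∈ S × (∀ {y} → y ∈ S → x ∉ N y)
  coreless⇒source {S} ne coreless
    with any? (λ x → (x ∈? S) ×-dec ¬? (any? λ y → (y ∈? S) ×-dec (x ∈? N y)))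
  ... | yes (x , x∈S , source) = x , x∈S , λ y∈S x∈Ny → source (_ , y∈S , x∈Ny)
  ... | no none =
    let C , C⊆S , core = in-closed⇒core S ne λ {x} x∈S → decidable-stable
          (any? λ y → (y ∈? S) ×-dec (x ∈? N y)) λ ¬in → none (x , x∈S , ¬in)
    in contradiction core (coreless C C⊆S)

  Happy : (Fin n → Bool) → Fin n → Set
  Happy c x = ∃ λ y → y ∈ N x × c y ≡ c x

  -- Outside U the colouring is already friendly.  Vertices of U are coloured one by one like an
  -- out-neighbour outside U; once none is left, the rest of U can be monochromatic.
  extend : ∀ V → (∀ {x} → x ∈ V → Nonempty (N x)) → ∀ U c →
           (∀ {x} → x ∈ V → x ∉ U → ∃ λ y → y ∉ U × y ∈ N x × c y ≡ c x) →
           ∃ λ d → (∀ {x} → x ∉ U → d x ≡ c x) × (∀ {x} → x ∈ V → Happy d x)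
  extend V out U = <-rec P step ∣ U ∣ U refl
    where
    P : ℕ → Set
    P k = ∀ U → ∣ U ∣ ≡ k → ∀ c →
           (∀ {x} → x ∈ V → x ∉ U → ∃ λ y → y ∉ U × y ∈ N x × c y ≡ c x) →
           ∃ λ d → (∀ {x} → x ∉ U → d x ≡ c x) × (∀ {x} → x ∈ V → Happy d x)
    step : ∀ k → (∀ {j} → j < k → P j) → P k
    step k rec U refl c happy
      with any? (λ x → (x ∈? U) ×-dec (x ∈? V) ×-dec any? λ y → ¬? (y ∈? U) ×-dec (y ∈? N x))
    ... | yes (x , x∈U , x∈V , y , y∉U , y∈Nx) =
      let d , d≡ , happy-d = rec (x∈p⇒∣p-x∣<∣p∣ x∈U) (U - x) refl c′ happy′
      in d , (λ z∉U → trans (d≡ (z∉U ∘ p─q⊆p U _)) (c′≡c z∉U)) , happy-d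
      where
      c′ = updateAt c x (const (c y))
      c′≡c : ∀ {z} → z ∉ U → c′ z ≡ c z
      c′≡c z∉U = updateAt-minimal _ x c λ { refl → z∉U x∈U }
      happy′ : ∀ {z} → z ∈ V → z ∉ U - x → ∃ λ w → w ∉ U - x × w ∈ N z × c′ w ≡ c′ z
      happy′ {z} z∈V z∉ with z ≟ x
      ... | yes refl = y , y∉U ∘ p─q⊆p U _ , y∈Nx , trans (c′≡c y∉U) (sym (updateAt-updates x c))
      ... | no z≢x =
        let z∉U = λ z∈U → z∉ (x∈p∧x≢y⇒x∈p-y z∈U z≢x)
            w , w∉U , w∈Nz , cw≡cz = happy z∈V z∉U
        in w , w∉U ∘ p─q⊆p U _ , w∈Nz , trans (c′≡c w∉U) (trans cw≡cz (sym (c′≡c z∉U)))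
    ... | no none = d , d≡c , happy-d
      where
      d : Fin n → Bool
      d x = does (x ∈? U) ∨ c x
      d≡c : ∀ {x} → x ∉ U → d x ≡ c x
      d≡c {x} x∉U = cong (_∨ c x) (dec-false (x ∈? U) x∉U)
      d≡true : ∀ {x} → x ∈ U → d x ≡ true
      d≡true {x} x∈U = cong (_∨ c x) (dec-true (x ∈? U) x∈U)
      happy-d : ∀ {x} → x ∈ V → Happy d x
      happy-d {x} x∈V with x ∈? U
      ... | no x∉U =
        let y , y∉U , y∈Nx , cy≡cx = happy x∈V x∉U
        in y , y∈Nx , trans (d≡c y∉U) cy≡cx
      ... | yes x∈U =
        let y , y∈Nx = out x∈V
            y∈U = decidable-stable (y ∈? U) λ y∉U → none (x , x∈U , x∈V , y , y∉U , y∈Nx)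
        in y , y∈Nx , d≡true y∈U

  -- Always treating a source first amounts to growing two disjoint paths from r and s, extending
  -- the one whose end comes first in a topological order of R.
  separate : ∀ R → Coreless R → (∀ {x} → x ∈ R → 2 ≤ ∣ N x ∣) → ∀ r s → r ≢ s →
             ∃ λ c → c r ≡ true × c s ≡ false × (∀ {x} → x ∈ R → Happy c x)
  separate R = <-rec P step ∣ R ∣ R refl
    where
    P : ℕ → Set
    P k = ∀ R → ∣ R ∣ ≡ k → Coreless R → (∀ {x} → x ∈ R → 2 ≤ ∣ N x ∣) → ∀ r s → r ≢ s →
          ∃ λ c → c r ≡ true × c s ≡ false × (∀ {x} → x ∈ R → Happy c x)
    step : ∀ k → (∀ {j} → j < k → P j) → P k
    step k rec R refl coreless out r s r≢s with nonempty? R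
    ... | no empty = (λ x → does (x ≟ r)) , dec-true (r ≟ r) refl , dec-false (s ≟ r) (≢-sym r≢s) ,
                     λ x∈R → contradiction (_ , x∈R) empty
    ... | yes ne with coreless⇒source ne coreless
    ... | x , x∈R , source = go (x ≟ r) (x ≟ s)
      where
      rec′ = rec (x∈p⇒∣p-x∣<∣p∣ x∈R) (R - x) refl (λ C C⊆ → coreless C (p─q⊆p R _ ∘ C⊆))
                 (out ∘ p─q⊆p R _)
      recolour : (Fin n → Bool) → Fin n → Fin n → Bool
      recolour c y = updateAt c x (const (c y))
      -- No vertex of `R` has the source x as an out-neighbour, so x can be recoloured like y
      -- without making another vertex unhappy.
      happy : ∀ {c y} → y ∈ N x → (∀ {z} → z ∈ R - x → Happy c z) →
              ∀ {z} → z ∈ R → Happy (recolour c y) z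
      happy {c} {y} y∈Nx happy-c {z} z∈R with z ≟ x
      ... | yes refl = y , y∈Nx , trans (updateAt-minimal y x c λ { refl → source x∈R y∈Nx })
                                        (sym (updateAt-updates x c))
      ... | no z≢x =
        let w , w∈Nz , cw≡cz = happy-c (x∈p∧x≢y⇒x∈p-y z∈R z≢x)
        in w , w∈Nz , trans (updateAt-minimal w x c λ w≡x → source z∈R (subst (_∈ N z) w≡x w∈Nz))
                            (trans cw≡cz (sym (updateAt-minimal z x c z≢x)))
      go : Dec (x ≡ r) → Dec (x ≡ s) →
           ∃ λ c → c r ≡ true × c s ≡ false × (∀ {z} → z ∈ R → Happy c z)
      -- The path ending at r moves on to y, which takes over the role of r in the smaller problem.
      -- Two out-neighbours guarantee one that differs from s.
      go (yes refl) _ =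
        let y , y∈Nx , y≢s = avoid₁ (out x∈R) s
            c , cy , cs , happy-c = rec′ y s y≢s
        in recolour c y , trans (updateAt-updates x c) cy ,
           trans (updateAt-minimal s x c (≢-sym r≢s)) cs , happy y∈Nx happy-c
      go (no _) (yes refl) =
        let y , y∈Nx , y≢r = avoid₁ (out x∈R) r
            c , cr , cy , happy-c = rec′ r y (≢-sym y≢r)
        in recolour c y , trans (updateAt-minimal r x c r≢s) cr ,
           trans (updateAt-updates x c) cy , happy y∈Nx happy-c
      go (no x≢r) (no x≢s) =
        let y , y∈Nx , _ = avoid₁ (out x∈R) r
            c , cr , cs , happy-c = rec′ r s r≢s
        in recolour c y , trans (updateAt-minimal r x c (≢-sym x≢r)) cr ,
           trans (updateAt-minimal s x c (≢-sym x≢s)) cs , happy y∈Nx happy-c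

  FriendlyOn : Subset n → (Fin n → Bool) → Set
  FriendlyOn V c = (∃ λ v → v ∈ V × c v ≡ true) × (∃ λ v → v ∈ V × c v ≡ false) ×
                   (∀ v → v ∈ V → Happy c v)

  friendlyOn? : ∀ V c → Dec (FriendlyOn V c)
  friendlyOn? V c =
    any? (λ v → (v ∈? V) ×-dec (c v ≟ᵇ true)) ×-dec
    any? (λ v → (v ∈? V) ×-dec (c v ≟ᵇ false)) ×-dec
    all? (λ v → (v ∈? V) →-dec any? λ w → (w ∈? N v) ×-dec (c w ≟ᵇ c v))

  FriendlyOn-cong : ∀ {V c d} → c ≗ d → FriendlyOn V c → FriendlyOn V d
  FriendlyOn-cong c≗d ((a , a∈V , ca) , (b , b∈V , cb) , happy) =
    (a , a∈V , trans (sym (c≗d a)) ca) , (b , b∈V , trans (sym (c≗d b)) cb) ,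
    λ v v∈V → let w , w∈ , cw≡cv = happy v v∈V
              in w , w∈ , trans (sym (c≗d w)) (trans cw≡cv (c≗d v))

SameOn : ∀ {n} → Subset n → (Fin n → Bool) → (Fin n → Bool) → Set
SameOn V c d = (∀ v → v ∈ V → d v ≡ c v) ⊎ (∀ v → v ∈ V → d v ≡ not (c v))

sameOn? : ∀ {n} (V : Subset n) c d → Dec (SameOn V c d)
sameOn? V c d = all? (λ v → (v ∈? V) →-dec (d v ≟ᵇ c v)) ⊎-dec
                all? (λ v → (v ∈? V) →-dec (d v ≟ᵇ not (c v)))

SameOn-restrict : ∀ {n} {W V : Subset n} {c d c′ d′} → W ⊆ V →
  (∀ {x} → x ∈ W → c′ x ≡ c x) → (∀ {x} → x ∈ W → d′ x ≡ d x) →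
  SameOn V c′ d′ → SameOn W c d
SameOn-restrict W⊆V c′≡c d′≡d = ⊎-map
  (λ same v v∈ → trans (sym (d′≡d v∈)) (trans (same v (W⊆V v∈)) (c′≡c v∈)))
  (λ same v v∈ → trans (sym (d′≡d v∈)) (trans (same v (W⊆V v∈)) (cong not (c′≡c v∈))))

TwoFriendly : ∀ {n} → Subset n → (Fin n → Subset n) → Set
TwoFriendly {n} V N = ∃ λ (c : Fin n → Bool) → ∃ λ (d : Fin n → Bool) →
  FriendlyOn N V c × FriendlyOn N V d × ¬ SameOn V c d

-- Colourings are encoded as subsets, of which there are finitely many to search. Decidability is
-- what allows an argument by minimal counterexample.
twoFriendly? : ∀ {n} V (N : Fin n → Subset n) → Dec (TwoFriendly V N)
twoFriendly? V N = map′
  (λ (c , d , rest) → lookup c , lookup d , rest)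
  (λ (c , d , fc , fd , c≁d) → tabulate c , tabulate d ,
    FriendlyOn-cong N (sym ∘ lookup∘tabulate c) fc , FriendlyOn-cong N (sym ∘ lookup∘tabulate d) fd ,
    c≁d ∘ SameOn-restrict id (λ _ → lookup∘tabulate c _) (λ _ → lookup∘tabulate d _))
  (anySubset? λ c → anySubset? λ d → friendlyOn? N V (lookup c) ×-dec
    friendlyOn? N V (lookup d) ×-dec ¬? (sameOn? V (lookup c) (lookup d)))

-- The vertex set is a subset of `Fin n`, so that contracted and induced digraphs live on the same
-- type. Outside `V` the values of `N` are arbitrary.
record ThreeOut {n : ℕ} (V : Subset n) (N : Fin n → Subset n) : Set where
  field
    nonempty : Nonempty V
    closed   : ∀ {x} → x ∈ V → N x ⊆ V
    loopless : ∀ {x} → x ∈ V → x ∉ N x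
    size     : ∀ {x} → x ∈ V → ∣ N x ∣ ≡ 3

-- Contraction of an arc

module Contraction {n : ℕ} {V : Subset n} {N : Fin n → Subset n} (G : ThreeOut V N) {u v : Fin n}
  (u∈V : u ∈ V) (v∈Nu : v ∈ N u) (u∉Nv : u ∉ N v)
  (no-common : ∀ {w} → w ∈ V → u ∈ N w → v ∉ N w) where

  open ThreeOut G

  -- The effect of contraction on an out-set: u disappears, and an arc into u now ends at v.
  redirect : Subset n → Subset n
  redirect p with u ∈? p
  ... | yes _ = (p [ u ]≔ outside) [ v ]≔ inside
  ... | no  _ = p

  v≢u : v ≢ u
  v≢u refl = loopless u∈V v∈Nu

  ∈-redirect⁻ : ∀ p {y} → y ∈ redirect p → (y ∈ p × y ≢ u) ⊎ (y ≡ v × u ∈ p)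
  ∈-redirect⁻ p {y} y∈ with u ∈? p
  ... | no u∉p = inj₁ (y∈ , λ { refl → u∉p y∈ })
  ... | yes u∈p with y ≟ v | y ≟ u
  ...   | yes y≡v | _ = inj₂ (y≡v , u∈p)
  ...   | no y≢v | yes refl = contradiction
          (trans (sym (lookup∘update u p outside))
            (trans (sym (lookup∘update′ y≢v (p [ u ]≔ outside) inside)) ([]=⇒lookup y∈))) λ ()
  ...   | no y≢v | no y≢u = inj₁ (lookup⇒[]= y p
          (trans (sym (lookup∘update′ y≢u p outside))
            (trans (sym (lookup∘update′ y≢v (p [ u ]≔ outside) inside)) ([]=⇒lookup y∈))) , y≢u)

  ∣redirect∣ : ∀ p → (u ∈ p → v ∉ p) → ∣ redirect p ∣ ≡ ∣ p ∣
  ∣redirect∣ p u∈p⇒v∉p with u ∈? p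
  ... | no _ = refl
  ... | yes u∈p = trans (∣p[x]≔inside∣ v (p [ u ]≔ outside) v∉) (∣p[x]≔outside∣ u∈p)
    where
    v∉ : v ∉ p [ u ]≔ outside
    v∉ v∈ = u∈p⇒v∉p u∈p
      (lookup⇒[]= v p (trans (sym (lookup∘update′ v≢u p outside)) ([]=⇒lookup v∈)))

  V/ : Subset n
  V/ = V - u

  N/ : Fin n → Subset n
  N/ = redirect ∘ N

  V/⊆V : V/ ⊆ V
  V/⊆V = p─q⊆p V _

  ≢u : ∀ {x} → x ∈ V/ → x ≢ u
  ≢u x∈ = x∉⁅y⁆⇒x≢y (x∈p─q⇒x∉q V _ x∈)

  v∈V/ : v ∈ V/
  v∈V/ = x∈p∧x≢y⇒x∈p-y (closed u∈V v∈Nu) v≢u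

  -- No loop arises at v because `u ∉ N v`, and no out-set shrinks because no vertex dominates both
  -- u and v.
  threeOut/ : ThreeOut V/ N/
  threeOut/ = record
    { nonempty = v , v∈V/
    ; closed = λ {x} x∈ y∈ → [ (λ (y∈Nx , y≢u) → x∈p∧x≢y⇒x∈p-y (closed (V/⊆V x∈) y∈Nx) y≢u)
                             , (λ { (refl , _) → v∈V/ }) ]′ (∈-redirect⁻ (N x) y∈)
    ; loopless = λ {x} x∈ x∈N/ → [ (λ (x∈Nx , _) → loopless (V/⊆V x∈) x∈Nx)
                                 , (λ { (refl , u∈Nv) → u∉Nv u∈Nv }) ]′ (∈-redirect⁻ (N x) x∈N/)
    ; size = λ {x} x∈ → trans (∣redirect∣ (N x) (no-common (V/⊆V x∈))) (size (V/⊆V x∈))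
    }

  lift : (Fin n → Bool) → Fin n → Bool
  lift c = updateAt c u (const (c v))

  lift-≡ : ∀ c {x} → x ≢ u → lift c x ≡ c x
  lift-≡ c {x} = updateAt-minimal x u c

  lift-u : ∀ c → lift c u ≡ c v
  lift-u c = updateAt-updates u c

  -- The vertex u copies the colour of its out-neighbour v. A vertex whose witness is a redirected
  -- arc to v uses the original arc to u instead.
  lift-friendly : ∀ {c} → FriendlyOn N/ V/ c → FriendlyOn N V (lift c)
  lift-friendly {c} ((a , a∈ , ca) , (b , b∈ , cb) , happy) =
    (a , V/⊆V a∈ , trans (lift-≡ c (≢u a∈)) ca) , (b , V/⊆V b∈ , trans (lift-≡ c (≢u b∈)) cb) , happy′
    where
    happy′ : ∀ x → x ∈ V → Happy N (lift c) x
    happy′ x x∈V with x ≟ u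
    ... | yes refl = v , v∈Nu , trans (lift-≡ c v≢u) (sym (lift-u c))
    ... | no x≢u with happy x (x∈p∧x≢y⇒x∈p-y x∈V x≢u)
    ...   | y , y∈ , cy≡cx with ∈-redirect⁻ (N x) y∈
    ...     | inj₁ (y∈Nx , y≢u) = y , y∈Nx , trans (lift-≡ c y≢u) (trans cy≡cx (sym (lift-≡ c x≢u)))
    ...     | inj₂ (refl , u∈Nx) = u , u∈Nx , trans (lift-u c) (trans cy≡cx (sym (lift-≡ c x≢u)))

  lift-two : TwoFriendly V/ N/ → TwoFriendly V N
  lift-two (c , d , fc , fd , c≁d) = lift c , lift d , lift-friendly fc , lift-friendly fd ,
    c≁d ∘ SameOn-restrict V/⊆V (lift-≡ c ∘ ≢u) (lift-≡ d ∘ ≢u)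

-- Minimal counterexamples

module MinimalCounterexample {n : ℕ} {V : Subset n} {N : Fin n → Subset n} (G : ThreeOut V N)
  (ih : ∀ {W : Subset n} {M : Fin n → Subset n} → ∣ W ∣ < ∣ V ∣ → ThreeOut W M → TwoFriendly W M)
  (¬two : ¬ TwoFriendly V N) where

  open ThreeOut G

  out : ∀ {x} → x ∈ V → Nonempty (N x)
  out {x} x∈V = let y , y∈ , _ = avoid₁ {p = N x} (≤-trans (n≤1+n 2) (≤-reflexive (sym (size x∈V)))) x
                in y , y∈

  out≢ : ∀ {x y} → x ∈ V → y ∈ N x → y ≢ x
  out≢ x∈V y∈Nx refl = loopless x∈V y∈Nx

  unique : ∀ {c d} → FriendlyOn N V c → FriendlyOn N V d → SameOn V c d
  unique {c} {d} fc fd = decidable-stable (sameOn? V c d) λ c≁d → ¬two (c , d , fc , fd , c≁d)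

  common-in-neighbour : ∀ {u v} → u ∈ V → v ∈ N u → u ∉ N v → ∃ λ w → w ∈ V × u ∈ N w × v ∈ N w
  common-in-neighbour {u} {v} u∈V v∈Nu u∉Nv =
    decidable-stable (any? λ w → (w ∈? V) ×-dec (u ∈? N w) ×-dec (v ∈? N w)) λ none →
      let open Contraction G u∈V v∈Nu u∉Nv (λ w∈V u∈Nw v∈Nw → none (_ , w∈V , u∈Nw , v∈Nw))
      in ¬two (lift-two (ih (x∈p⇒∣p-x∣<∣p∣ u∈V) threeOut/))

  -- If no arc left `W`, then `ih` would apply to the digraph induced on `W`, and `extend` would
  -- carry its two partitions over to `V`.
  escape : ∀ {W} → W ⊆ V → Nonempty W → (∃ λ v → v ∈ V × v ∉ W) →
           ∃ λ x → ∃ λ y → x ∈ W × y ∈ N x × y ∉ W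
  escape {W} W⊆V ne (v , v∈V , v∉W) =
    decidable-stable (any? λ x → any? λ y → (x ∈? W) ×-dec (y ∈? N x) ×-dec ¬? (y ∈? W)) λ none →
      let stays : ∀ {x} → x ∈ W → N x ⊆ W
          stays x∈W {y} y∈Nx = decidable-stable (y ∈? W) λ y∉W → none (_ , y , x∈W , y∈Nx , y∉W)
          c , d , fc , fd , c≁d = ih (p⊂q⇒∣p∣<∣q∣ (W⊆V , v , v∈V , v∉W)) record
            { nonempty = ne ; closed = stays ; loopless = loopless ∘ W⊆V ; size = size ∘ W⊆V }
          c′ , c′≡c , fc′ = extend-friendly stays fc
          d′ , d′≡d , fd′ = extend-friendly stays fd
      in ¬two (c′ , d′ , fc′ , fd′ , c≁d ∘ SameOn-restrict W⊆V c′≡c d′≡d)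
    where
    extend-friendly : (∀ {x} → x ∈ W → N x ⊆ W) → ∀ {c} → FriendlyOn N W c →
                      ∃ λ d → (∀ {x} → x ∈ W → d x ≡ c x) × FriendlyOn N V d
    extend-friendly stays {c} ((a , a∈ , ca) , (b , b∈ , cb) , happy) =
      let d , d≡c , happy-d = extend N V out (∁ W) c λ x∈V x∉∁W →
            let x∈W = x∉∁p⇒x∈p x∉∁W ; y , y∈Nx , cy≡cx = happy _ x∈W
            in y , x∈p⇒x∉∁p (stays x∈W y∈Nx) , y∈Nx , cy≡cx
          d≡ = λ {x} x∈W → d≡c {x} (x∈p⇒x∉∁p x∈W)
      in d , d≡ , (a , W⊆V a∈ , trans (d≡ a∈) ca) , (b , W⊆V b∈ , trans (d≡ b∈) cb) , λ _ → happy-d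

  -- Vertices of `C` and `D` are happy inside their own cores, so `extend` only has to colour the
  -- vertices outside both.
  disjoint-cores⇒friendly : ∀ {C D} → C ⊆ V → D ⊆ V → Core N C → Core N D →
    (∀ {x} → x ∈ C → x ∉ D) →
    ∃ λ c → FriendlyOn N V c × (∀ {x} → x ∈ C → c x ≡ true) × (∀ {x} → x ∈ D → c x ≡ false)
  disjoint-cores⇒friendly {C} {D} C⊆V D⊆V ((a , a∈C) , outC) ((b , b∈D) , outD) disjoint =
    let d , d≡c , happy = extend N V out (∁ (C ∪ D)) c λ _ x∉ →
          [ (λ x∈C → let y , y∈C , y∈Nx = outC x∈C
                     in y , x∈p⇒x∉∁p (p⊆p∪q D y∈C) , y∈Nx , trans (c-C y∈C) (sym (c-C x∈C)))
          , (λ x∈D → let y , y∈D , y∈Nx = outD x∈D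
                     in y , x∈p⇒x∉∁p (q⊆p∪q C D y∈D) , y∈Nx , trans (c-D y∈D) (sym (c-D x∈D))) ]′
          (x∈p∪q⁻ C D (x∉∁p⇒x∈p x∉))
        d-C = λ {x} x∈C → trans (d≡c {x} (x∈p⇒x∉∁p (p⊆p∪q D x∈C))) (c-C x∈C)
        d-D = λ {x} x∈D → trans (d≡c {x} (x∈p⇒x∉∁p (q⊆p∪q C D x∈D))) (c-D x∈D)
    in d , ((a , C⊆V a∈C , d-C a∈C) , (b , D⊆V b∈D , d-D b∈D) , λ _ → happy) , d-C , d-D
    where
    c : Fin n → Bool
    c x = does (x ∈? C)
    c-C : ∀ {x} → x ∈ C → c x ≡ true
    c-C {x} = dec-true (x ∈? C)
    c-D : ∀ {x} → x ∈ D → c x ≡ false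
    c-D {x} x∈D = dec-false (x ∈? C) λ x∈C → disjoint x∈C x∈D

  -- By uniqueness, the friendly colouring grown from `C` and `D` is c or its negation on `V`.
  disjoint-cores-split : ∀ {c C D} → FriendlyOn N V c → C ⊆ V → D ⊆ V → Core N C → Core N D →
    (∀ {x} → x ∈ C → x ∉ D) →
    ∃ λ b → (∀ {x} → x ∈ C → c x ≡ b) × (∀ {x} → x ∈ D → c x ≡ not b)
  disjoint-cores-split {c} fc C⊆V D⊆V coreC coreD disjoint
    with disjoint-cores⇒friendly C⊆V D⊆V coreC coreD disjoint
  ... | d , fd , d-C , d-D with unique fd fc
  ...   | inj₁ c≡d = true , (λ x∈C → trans (c≡d _ (C⊆V x∈C)) (d-C x∈C)) ,
                            (λ x∈D → trans (c≡d _ (D⊆V x∈D)) (d-D x∈D))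
  ...   | inj₂ c≡¬d = false , (λ x∈C → trans (c≡¬d _ (C⊆V x∈C)) (cong not (d-C x∈C))) ,
                              (λ x∈D → trans (c≡¬d _ (D⊆V x∈D)) (cong not (d-D x∈D)))

  -- Otherwise x could be moved to the other class.
  exit∈core : ∀ {c C b x y} → FriendlyOn N V c → C ⊆ V → Core N C → (∀ {z} → z ∈ C → c z ≡ b) →
              x ∈ V → c x ≡ b → y ∈ N x → c y ≡ not b → x ∈ C
  exit∈core {c} {C} {b} {x} {y} fc C⊆V coreC c-C x∈V cx y∈Nx cy = decidable-stable (x ∈? C) λ x∉C →
    let b′ , c-C′ , c-D = disjoint-cores-split fc C⊆V (proj₁ ∘ ∈-sep⁻ D?) coreC coreD λ z∈C z∈D →
          [ (λ cz → not-¬ (c-C z∈C) cz) , (λ { refl → x∉C z∈C }) ]′ (proj₂ (∈-sep⁻ D? z∈D))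
        b≡b′ = trans (sym (c-C (proj₂ (proj₁ coreC)))) (c-C′ (proj₂ (proj₁ coreC)))
    in not-¬ cx (trans (c-D (∈-sep⁺ D? (x∈V , inj₂ refl))) (cong not (sym b≡b′)))
    where
    -- The opposite class together with x. It is a core because x has the out-neighbour y in it, and
    -- it is disjoint from `C` when x is not in `C`; the split then forces the wrong colour on x.
    D? : Decidable (λ z → z ∈ V × (c z ≡ not b ⊎ z ≡ x))
    D? z = (z ∈? V) ×-dec ((c z ≟ᵇ not b) ⊎-dec (z ≟ x))
    y∈D : y ∈ sep D?
    y∈D = ∈-sep⁺ D? (closed x∈V y∈Nx , inj₁ cy)
    coreD : Core N (sep D?)
    coreD = (y , y∈D) , λ z∈D → outD (∈-sep⁻ D? z∈D)
      where
      outD : ∀ {z} → z ∈ V × (c z ≡ not b ⊎ z ≡ x) → HasOut N (sep D?) z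
      outD (z∈V , inj₁ cz) = let w , w∈Nz , cw≡cz = proj₂ (proj₂ fc) _ z∈V
        in w , ∈-sep⁺ D? (closed z∈V w∈Nz , inj₁ (trans cw≡cz cz)) , w∈Nz
      outD (_ , inj₂ refl) = y , y∈D , y∈Nx

  side? : ∀ (c : Fin n → Bool) b → Decidable (λ z → z ∈ V × c z ≡ b)
  side? c b z = (z ∈? V) ×-dec (c z ≟ᵇ b)

  side-core : ∀ {c b x} → FriendlyOn N V c → x ∈ V → c x ≡ b → Core N (sep (side? c b))
  side-core {c} {b} fc x∈V cx = (_ , ∈-sep⁺ (side? c b) (x∈V , cx)) , λ z∈ →
    let z∈V , cz = ∈-sep⁻ (side? c b) z∈
        w , w∈Nz , cw≡cz = proj₂ (proj₂ fc) _ z∈V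
    in w , ∈-sep⁺ (side? c b) (closed z∈V w∈Nz , trans cw≡cz cz) , w∈Nz

  exit : ∀ {c b x y} → FriendlyOn N V c → x ∈ V → c x ≡ b → y ∈ V → c y ≡ not b →
         ∃ λ x → ∃ λ y → x ∈ V × c x ≡ b × y ∈ N x × c y ≡ not b
  exit {c} {b} fc x∈V cx y∈V cy =
    let x , y , x∈ , y∈Nx , y∉ = escape (proj₁ ∘ ∈-sep⁻ (side? c b)) (_ , ∈-sep⁺ (side? c b) (x∈V , cx))
          (_ , y∈V , λ y∈ → not-¬ (proj₂ (∈-sep⁻ (side? c b) y∈)) cy)
        x∈V , cx = ∈-sep⁻ (side? c b) x∈
    in x , y , x∈V , cx , y∈Nx ,
       ¬-not λ cy → y∉ (∈-sep⁺ (side? c b) (closed x∈V y∈Nx , cy))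

  -- Digraphs without 2-cycles

  module NoDigon (no-digon : ∀ {x y} → x ∈ V → y ∈ N x → x ∉ N y) where

    In? : ∀ y → Decidable (λ x → x ∈ V × y ∈ N x)
    In? y x = (x ∈? V) ×-dec (y ∈? N x)

    In : Fin n → Subset n
    In y = sep (In? y)

    In⊆V : ∀ y → In y ⊆ V
    In⊆V y = proj₁ ∘ ∈-sep⁻ (In? y)

    -- A walk x → y → z inside the core has three distinct vertices, since there are neither loops
    -- nor 2-cycles.
    core-size : ∀ {C} → C ⊆ V → Core N C → 3 ≤ ∣ C ∣
    core-size C⊆V ((x , x∈C) , outC) =
      let y , y∈C , y∈Nx = outC x∈C
          z , z∈C , z∈Ny = outC y∈C
      in three-elements x∈C y∈C z∈C
           (out≢ (C⊆V x∈C) y∈Nx)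
           (λ z≡x → no-digon (C⊆V x∈C) y∈Nx (subst (_∈ N y) z≡x z∈Ny))
           (out≢ (C⊆V y∈C) z∈Ny)

    -- For x in `In y`, the arc x → y has no reverse, so a common in-neighbour of x and y is an
    -- in-neighbour of x inside `In y`.
    in-core : ∀ {y} → y ∈ V → ∃ λ C → C ⊆ In y × Core N C
    in-core {y} y∈V = in-closed⇒core N (In y) nonempty-In λ x∈ →
      let x∈V , y∈Nx = ∈-sep⁻ (In? y) x∈
          w , w∈V , x∈Nw , y∈Nw = common-in-neighbour x∈V y∈Nx (no-digon x∈V y∈Nx)
      in w , ∈-sep⁺ (In? y) (w∈V , y∈Nw) , x∈Nw
      where
      nonempty-In : Nonempty (In y)
      nonempty-In =
        let a , a∈Ny = out y∈V
            a∈ = x∈p∧x≢y⇒x∈p-y (closed y∈V a∈Ny) (out≢ y∈V a∈Ny)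
            -- An arc leaving `V - y` can only end at y.
            x , z , x∈ , z∈Nx , z∉ = escape (p─q⊆p V _) (a , a∈)
              (y , y∈V , λ y∈ → x∈p─q⇒x∉q V _ y∈ (x∈⁅x⁆ y))
            x∈V = p─q⊆p V _ x∈
            z≡y = decidable-stable (z ≟ y) λ z≢y → z∉ (x∈p∧x≢y⇒x∈p-y (closed x∈V z∈Nx) z≢y)
        in x , ∈-sep⁺ (In? y) (x∈V , subst (_∈ N x) z≡y z∈Nx)

    -- All in-degrees are at least 3 and all out-degrees equal 3, so double counting gives equality.
    in-size : ∀ y → y ∈ V → ∣ In y ∣ ≤ 3
    in-size y y∈V = ≤-trans
      (≤∧sum≥⇒≥ out≤in (≤-reflexive (sym (double-count λ x y → In? y x))) y) (out≤3 y∈V)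
      where
      Out : Fin n → Subset n
      Out x = sep (λ y → In? y x)
      out≤3 : ∀ {x} → x ∈ V → ∣ Out x ∣ ≤ 3
      out≤3 {x} x∈V = ≤-trans (p⊆q⇒∣p∣≤∣q∣ (proj₂ ∘ ∈-sep⁻ (λ y → In? y x))) (≤-reflexive (size x∈V))
      cases : ∀ x → Dec (x ∈ V) → ∣ Out x ∣ ≤ ∣ In x ∣
      cases x (yes x∈V) = let C , C⊆ , core = in-core x∈V in
        ≤-trans (out≤3 x∈V) (≤-trans (core-size (In⊆V x ∘ C⊆) core) (p⊆q⇒∣p∣≤∣q∣ C⊆))
      -- Here `Out x` is empty, since only arcs with tail in `V` are counted.
      cases x (no x∉V) = p⊆q⇒∣p∣≤∣q∣ {q = In x} λ y∈ → contradiction (proj₁ (∈-sep⁻ (λ y → In? y x) y∈)) x∉V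
      out≤in : ∀ x → ∣ Out x ∣ ≤ ∣ In x ∣
      out≤in x = cases x (x ∈? V)

    -- The core inside `In y` has at least 3 vertices and `In y` at most 3, so they coincide.
    In-core : ∀ {y} → y ∈ V → Core N (In y)
    In-core {y} y∈V =
      let C , C⊆ , core = in-core y∈V
          In⊆C = ⊆∧∣≤∣⇒⊇ C⊆ (≤-trans (in-size y y∈V) (core-size (In⊆V y ∘ C⊆) core))
      in map₂ C⊆ (proj₁ core) , λ x∈ → let z , z∈C , z∈Nx = proj₂ core (In⊆C x∈) in z , C⊆ z∈C , z∈Nx

    -- A sink z of V ─ In p would have N z = In p, so In z would be a core of V ─ In p.
    disjoint-from-In : ∀ {p} → p ∈ V →
      ¬ (∀ D → D ⊆ V → Core N D → ¬ (∀ {x} → x ∈ In p → x ∉ D))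
    disjoint-from-In {p} p∈V none =
      let z , z∈ , sink = coreless⇒sink N (p , x∈p∧x∉q⇒x∈p─q p∈V p∉In) λ C C⊆ core →
            none C (p─q⊆p V _ ∘ C⊆) core λ x∈In x∈C → x∈p─q⇒x∉q V _ (C⊆ x∈C) x∈In
          z∈V = p─q⊆p V _ z∈
          Nz⊆In : N z ⊆ In p
          Nz⊆In {y} y∈Nz = decidable-stable (y ∈? In p) λ y∉ →
            sink (y , x∈p∧x∉q⇒x∈p─q (closed z∈V y∈Nz) y∉ , y∈Nz)
          In⊆Nz = ⊆∧∣≤∣⇒⊇ Nz⊆In (≤-trans (in-size p p∈V) (≤-reflexive (sym (size z∈V))))
      -- A vertex in both `In z` and `In p`, which equals `N z`, would form a 2-cycle with z.
      in none (In z) (In⊆V z) (In-core z∈V) λ x∈Inp x∈Inz →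
           let x∈V , z∈Nx = ∈-sep⁻ (In? z) x∈Inz in no-digon x∈V z∈Nx (In⊆Nz x∈Inp)
      where
      p∉In : p ∉ In p
      p∉In p∈ = loopless p∈V (proj₂ (∈-sep⁻ (In? p) p∈))

    absurd : ⊥
    absurd = let p , p∈V = nonempty in
      disjoint-from-In p∈V λ D D⊆V coreD disjoint →
        let c , fc , _ = disjoint-cores⇒friendly (In⊆V p) D⊆V (In-core p∈V) coreD disjoint
        in unique-friendly fc
      where
      unique-friendly : ∀ {c} → FriendlyOn N V c → ⊥
      unique-friendly {c} fc@((a , a∈V , ca) , (b , b∈V , cb) , happy) =
        -- For an arc x → y leaving the class of true, a core disjoint from `In x` forces `In x`
        -- into a single class. `refute` excludes both classes.
        let x , y , x∈V , cx , y∈Nx , cy = exit fc a∈V ca b∈V cb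
        in disjoint-from-In x∈V λ D D⊆V coreD disjoint →
             refute x∈V cx y∈Nx cy
               (map₂ proj₁ (disjoint-cores-split fc (In⊆V x) D⊆V (In-core x∈V) coreD disjoint))
        where
        A? = side? c true
        refute : ∀ {x y} → x ∈ V → c x ≡ true → y ∈ N x → c y ≡ false →
                 ¬ (∃ λ b → ∀ {z} → z ∈ In x → c z ≡ b)
        -- `In x` is a core in the class of x, so it must contain x, which gives a loop.
        refute {x} x∈V cx y∈Nx cy (true , c-In) =
          let x∈In = exit∈core fc (In⊆V x) (In-core x∈V) c-In x∈V cx y∈Nx cy
          in loopless x∈V (proj₂ (∈-sep⁻ (In? x) x∈In))
        -- No vertex in the class of x dominates x, so that class is still a core after x is
        -- removed, although each of its cores must contain x.
        refute {x} x∈V cx y∈Nx cy (false , c-In) =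
          let w , w∈A , w∈Nx = proj₂ coreA (∈-sep⁺ A? (x∈V , cx))
              x∈ = exit∈core fc (proj₁ ∘ ∈-sep⁻ A? ∘ p─q⊆p (sep A?) _)
                ((w , x∈p∧x≢y⇒x∈p-y w∈A (out≢ x∈V w∈Nx)) , λ z∈ →
                  let z∈A = p─q⊆p (sep A?) _ z∈ ; t , t∈A , t∈Nz = proj₂ coreA z∈A
                  in t , x∈p∧x≢y⇒x∈p-y t∈A (λ t≡x → no-in z∈A (subst (_∈ N _) t≡x t∈Nz)) , t∈Nz)
                (proj₂ ∘ ∈-sep⁻ A? ∘ p─q⊆p (sep A?) _) x∈V cx y∈Nx cy
          in x∈p─q⇒x∉q (sep A?) _ x∈ (x∈⁅x⁆ x)
          where
          coreA : Core N (sep A?)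
          coreA = side-core fc x∈V cx
          no-in : ∀ {z} → z ∈ sep A? → x ∉ N z
          no-in z∈A x∈Nz = let z∈V , cz = ∈-sep⁻ A? z∈A in
            contradiction (trans (sym cz) (c-In (∈-sep⁺ (In? x) (z∈V , x∈Nz)))) λ ()

  -- Digraphs with a 2-cycle

  module Digon {u v : Fin n} (u∈V : u ∈ V) (v∈Nu : v ∈ N u) (u∈Nv : u ∈ N v) where

    v∈V : v ∈ V
    v∈V = closed u∈V v∈Nu

    u≢v : u ≢ v
    u≢v refl = loopless u∈V v∈Nu

    3≤ : ∀ {x} → x ∈ V → 3 ≤ ∣ N x ∣
    3≤ x∈V = ≤-reflexive (sym (size x∈V))

    uv : Subset n
    uv = ⁅ u ⁆ ∪ ⁅ v ⁆

    c : Fin n → Bool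
    c x = does (x ∈? uv)

    c-u : c u ≡ true
    c-u = dec-true (u ∈? uv) (p⊆p∪q ⁅ v ⁆ (x∈⁅x⁆ u))

    c-v : c v ≡ true
    c-v = dec-true (v ∈? uv) (q⊆p∪q ⁅ u ⁆ ⁅ v ⁆ (x∈⁅x⁆ v))

    c-other : ∀ {x} → x ≢ u → x ≢ v → c x ≡ false
    c-other {x} x≢u x≢v = dec-false (x ∈? uv)
      ([ x≢u ∘ x∈⁅y⁆⇒x≡y u , x≢v ∘ x∈⁅y⁆⇒x≡y v ]′ ∘ x∈p∪q⁻ ⁅ u ⁆ ⁅ v ⁆)

    -- u and v serve each other, and any other vertex has one of its three out-neighbours outside
    -- {u, v}.
    c-friendly : FriendlyOn N V c
    c-friendly =
      let w , w∈Nu , w≢u , w≢v = avoid₂ (3≤ u∈V) u v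
      in (u , u∈V , c-u) , (w , closed u∈V w∈Nu , c-other w≢u w≢v) , happy
      where
      happy : ∀ x → x ∈ V → Happy N c x
      happy x x∈V with x ≟ u | x ≟ v
      ... | yes refl | _ = v , v∈Nu , trans c-v (sym c-u)
      ... | no _ | yes refl = u , u∈Nv , trans c-u (sym c-v)
      ... | no x≢u | no x≢v = let w , w∈Nx , w≢u , w≢v = avoid₂ (3≤ x∈V) u v
        in w , w∈Nx , trans (c-other w≢u w≢v) (sym (c-other x≢u x≢v))

    B? : Decidable (λ x → x ∈ V × c x ≡ false)
    B? = side? c false

    B : Subset n
    B = sep B?

    Exit : Fin n → Set
    Exit x = ∃ λ y → y ∈ N x × c y ≡ true

    Y? : Decidable (λ x → x ∈ B × u ∈ N x × v ∈ N x)
    Y? x = (x ∈? B) ×-dec (u ∈? N x) ×-dec (v ∈? N x)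

    exit∈core-of-B : ∀ {x C} → x ∈ B → Exit x → C ⊆ B → Core N C → x ∈ C
    exit∈core-of-B x∈B (y , y∈Nx , cy) C⊆B core =
      let x∈V , cx = ∈-sep⁻ B? x∈B
      in exit∈core c-friendly (proj₁ ∘ ∈-sep⁻ B? ∘ C⊆B) core (proj₂ ∘ ∈-sep⁻ B? ∘ C⊆B) x∈V cx y∈Nx cy

    sink-above : ∀ {x} → x ∈ B → Exit x → ∃ λ z → z ∈ sep Y? × x ∈ N z
    sink-above {x} x∈B exit-x =
      let x∈V , cx = ∈-sep⁻ B? x∈B
          w , w∈B , w∈Nx = proj₂ (side-core c-friendly x∈V cx) x∈B
          z , z∈ , sink = coreless⇒sink N
            (w , x∈p∧x≢y⇒x∈p-y w∈B (out≢ x∈V w∈Nx)) λ C C⊆ core →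
            x∈p─q⇒x∉q B _ (C⊆ (exit∈core-of-B x∈B exit-x (p─q⊆p B _ ∘ C⊆) core)) (x∈⁅x⁆ x)
          z∈B = p─q⊆p B _ z∈
          z∈V = proj₁ (∈-sep⁻ B? z∈B)
          Nz⊆ : N z ⊆ uv ∪ ⁅ x ⁆
          Nz⊆ {y} y∈Nz = decidable-stable (y ∈? uv ∪ ⁅ x ⁆) λ y∉ →
            sink (y , x∈p∧x∉q⇒x∈p─q
              (∈-sep⁺ B? (closed z∈V y∈Nz , dec-false (y ∈? uv) (y∉ ∘ p⊆p∪q _))) (y∉ ∘ q⊆p∪q uv _) , y∈Nz)
          -- The set {u, v, x} has at most 3 elements and `N z` has 3, so the inclusion is an
          -- equality.
          ⊆Nz = ⊆∧∣≤∣⇒⊇ Nz⊆ (≤-trans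
            (≤-trans (∣p∪q∣≤∣p∣+∣q∣ uv ⁅ x ⁆) (+-mono-≤ (∣⁅x⁆∪⁅y⁆∣≤2 u v) (≤-reflexive (∣⁅x⁆∣≡1 x)))) (3≤ z∈V))
      in z , ∈-sep⁺ Y? (z∈B , ⊆Nz (p⊆p∪q _ (p⊆p∪q _ (x∈⁅x⁆ u))) ,
                              ⊆Nz (p⊆p∪q _ (q⊆p∪q ⁅ u ⁆ _ (x∈⁅x⁆ v)))) ,
         ⊆Nz (q⊆p∪q uv _ (x∈⁅x⁆ x))

    some-exit : ∃ λ x → x ∈ B × Exit x
    some-exit =
      let _ , (b , b∈V , cb) , _ = c-friendly
          x , y , x∈V , cx , y∈Nx , cy = exit c-friendly b∈V cb u∈V c-u
      in x , ∈-sep⁺ B? (x∈V , cx) , y , y∈Nx , cy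

    -- A vertex dominating u and v has an exit, so `sink-above` gives it an in-neighbour that again
    -- dominates both.
    core-in-Y : ∃ λ C → C ⊆ sep Y? × Core N C
    core-in-Y = in-closed⇒core N (sep Y?)
      (let x , x∈B , exit-x = some-exit ; z , z∈Y , _ = sink-above x∈B exit-x in z , z∈Y)
      λ y∈Y → let y∈B , u∈Ny , _ = ∈-sep⁻ Y? y∈Y in sink-above y∈B (u , u∈Ny , c-u)

    -- A vertex of `B` with an exit lies in every core of `B`, in particular in the one all of whose
    -- vertices dominate u and v.
    exit⇒u∧v : ∀ {x} → x ∈ B → Exit x → u ∈ N x × v ∈ N x
    exit⇒u∧v x∈B exit-x =
      let C , C⊆Y , core = core-in-Y
      in proj₂ (∈-sep⁻ Y? (C⊆Y (exit∈core-of-B x∈B exit-x (proj₁ ∘ ∈-sep⁻ Y? ∘ C⊆Y) core)))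

    R? : Decidable (λ x → x ∈ B × u ∉ N x × v ∉ N x)
    R? x = (x ∈? B) ×-dec ¬? (u ∈? N x) ×-dec ¬? (v ∈? N x)

    -- A core here would be a core of `B` and so contain every vertex of `B` with an exit, but
    -- vertices dominating neither u nor v have none.
    R-coreless : Coreless N (sep R?)
    R-coreless C C⊆R core =
      let x , x∈B , exit-x = some-exit
          _ , u∉Nx , _ = ∈-sep⁻ R? (C⊆R (exit∈core-of-B x∈B exit-x (proj₁ ∘ ∈-sep⁻ R? ∘ C⊆R) core))
      in u∉Nx (proj₁ (exit⇒u∧v x∈B exit-x))

    absurd : ⊥
    absurd =
      -- Distinct starting points outside {u, v} for the two paths; r differs from u by
      -- looplessness, so three out-neighbours suffice.
      let s , s∈Nv , s≢u , s≢v = avoid₂ (3≤ v∈V) u v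
          r , r∈Nu , r≢v , r≢s = avoid₂ (3≤ u∈V) v s
          d , dr , ds , happy = separate N (sep R?) R-coreless
            (λ x∈R → ≤-trans (n≤1+n 2) (3≤ (proj₁ (∈-sep⁻ B? (proj₁ (∈-sep⁻ R? x∈R)))))) r s r≢s
      in refute d (r , r∈Nu , trans (e-other d (out≢ u∈V r∈Nu) r≢v) dr) (s , s∈Nv , trans (e-other d s≢u s≢v) ds) happy
      where
      module _ (d : Fin n → Bool) where
        d[u] e : Fin n → Bool
        d[u] = updateAt d u (const true)
        e = updateAt d[u] v (const false)
        e-u : e u ≡ true
        e-u = trans (updateAt-minimal u v d[u] u≢v) (updateAt-updates u d)
        e-v : e v ≡ false
        e-v = updateAt-updates v d[u]
        e-other : ∀ {x} → x ≢ u → x ≢ v → e x ≡ d x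
        e-other {x} x≢u x≢v = trans (updateAt-minimal x v d[u] x≢v) (updateAt-minimal x u d x≢u)
        refute : (∃ λ r → r ∈ N u × e r ≡ true) → (∃ λ s → s ∈ N v × e s ≡ false) →
                 (∀ {x} → x ∈ sep R? → Happy N d x) → ⊥
        refute (r , r∈Nu , er) (s , s∈Nv , es) happy =
          -- The colouring e separates u from v while c does not, so e is neither c nor its
          -- negation.
          [ (λ e≡c → contradiction (trans (sym e-v) (trans (e≡c v v∈V) c-v)) λ ())
          , (λ e≡¬c → contradiction (trans (sym e-u) (trans (e≡¬c u u∈V) (cong not c-u))) λ ()) ]′
          (unique c-friendly ((u , u∈V , e-u) , (v , v∈V , e-v) , happy-e))
          where
          -- u and v have different colours under e, so one of them matches x.
          happy-both : ∀ {x} → u ∈ N x × v ∈ N x → Happy N e x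
          happy-both {x} (u∈Nx , v∈Nx) with e x
          ... | true  = u , u∈Nx , e-u
          ... | false = v , v∈Nx , e-v
          happy-e : ∀ x → x ∈ V → Happy N e x
          happy-e x x∈V with x ≟ u | x ≟ v
          ... | yes refl | _ = r , r∈Nu , trans er (sym e-u)
          ... | no _ | yes refl = s , s∈Nv , trans es (sym e-v)
          ... | no x≢u | no x≢v with u ∈? N x | v ∈? N x
          ...   | yes u∈Nx | _ = happy-both (exit⇒u∧v (∈-sep⁺ B? (x∈V , c-other x≢u x≢v)) (u , u∈Nx , c-u))
          ...   | no _ | yes v∈Nx = happy-both (exit⇒u∧v (∈-sep⁺ B? (x∈V , c-other x≢u x≢v)) (v , v∈Nx , c-v))
          ...   | no u∉Nx | no v∉Nx =
            -- x dominates neither u nor v, so its witness under d is unaffected by recolouring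
            -- those two.
            let w , w∈Nx , dw≡dx = happy (∈-sep⁺ R? (∈-sep⁺ B? (x∈V , c-other x≢u x≢v) , u∉Nx , v∉Nx))
                w≢u = λ w≡u → u∉Nx (subst (_∈ N x) w≡u w∈Nx)
                w≢v = λ w≡v → v∉Nx (subst (_∈ N x) w≡v w∈Nx)
            in w , w∈Nx , trans (e-other w≢u w≢v) (trans dw≡dx (sym (e-other x≢u x≢v)))

  absurd : ⊥
  absurd with any? (λ x → any? λ y → (x ∈? V) ×-dec (y ∈? N x) ×-dec (x ∈? N y))
  ... | yes (_ , _ , x∈V , y∈Nx , x∈Ny) = Digon.absurd x∈V y∈Nx x∈Ny
  ... | no none = NoDigon.absurd λ x∈V y∈Nx x∈Ny → none (_ , _ , x∈V , y∈Nx , x∈Ny)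

-- Induction on the number of vertices, and trimming of out-degrees

threeOut⇒twoFriendly : ∀ {n} (V : Subset n) (N : Fin n → Subset n) → ThreeOut V N → TwoFriendly V N
threeOut⇒twoFriendly {n} V N = <-rec P step ∣ V ∣ V N refl
  where
  P : ℕ → Set
  P k = ∀ (V : Subset n) N → ∣ V ∣ ≡ k → ThreeOut V N → TwoFriendly V N
  step : ∀ k → (∀ {j} → j < k → P j) → P k
  step k rec V N refl G = decidable-stable (twoFriendly? V N)
    (MinimalCounterexample.absurd G λ W<V → rec W<V _ _ refl)

count≡∣tabulate∣ : ∀ {n} (f : Fin n → Bool) → count f ≡ ∣ tabulate f ∣
count≡∣tabulate∣ {zero} f = refl
count≡∣tabulate∣ {suc n} f with f zero
... | true  = cong suc (count≡∣tabulate∣ (f ∘ suc))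
... | false = count≡∣tabulate∣ (f ∘ suc)

theorem1p7 : (n : ℕ) → n ≥ 1 → (G : Digraph n) → minOutDegAtLeast 3 G →
    ∃ λ (c : Fin n → Bool) → ∃ λ (d : Fin n → Bool) →
    Friendly G c × Friendly G d × ¬ SamePartition c d
theorem1p7 (suc m) _ G deg =
  let c , d , fc , fd , c≁d = threeOut⇒twoFriendly ⊤ N record
        { nonempty = zero , ∈⊤
        ; closed = λ _ _ → ∈⊤
        ; loopless = λ {x} _ x∈Nx → contradiction (trans (sym (arc-N x∈Nx)) (noLoop G x)) λ ()
        ; size = λ {x} _ → proj₂ (proj₂ (chosen x)) }
  in c , d , friendly fc , friendly fd ,
     c≁d ∘ ⊎-map (λ same v _ → same v) (λ same v _ → same v)
  where
  chosen : ∀ x → ∃ λ q → q ⊆ tabulate (arc G x) × ∣ q ∣ ≡ 3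
  chosen x = subset-of-size 3 (tabulate (arc G x)) (subst (3 ≤_) (count≡∣tabulate∣ (arc G x)) (deg x))
  N : Fin (suc m) → Subset (suc m)
  N x = proj₁ (chosen x)
  arc-N : ∀ {x y} → y ∈ N x → arc G x y ≡ true
  arc-N {x} {y} y∈Nx =
    trans (sym (lookup∘tabulate (arc G x) y)) ([]=⇒lookup (proj₁ (proj₂ (chosen x)) y∈Nx))
  -- Trimming only removes arcs, so every witness in `N` is also one in `G`.
  friendly : ∀ {c} → FriendlyOn N ⊤ c → Friendly G c
  friendly ((a , _ , ca) , (b , _ , cb) , happy) = (a , ca) , (b , cb) ,
    λ v → let w , w∈Nv , cw≡cv = happy v ∈⊤ in w , arc-N w∈Nv , cw≡cv
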